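{- Let $s,t\ge 2$ be integers, and let $G$ be a $C_4$-free graph such that every non-empty induced subgraph of $G$ has a bisimplicial vertex. If $\omega(G)<\chi(G)=s+t-1$, then $G$ is $(s,t)$-splittable.
   Context: All graphs are finite and simple. $\omega(G)$ denotes the clique number and $\chi(G)$ the chromatic number of $G$. For $A\subseteq V(G)$, $G[A]$ is the subgraph of $G$ induced by $A$. A clique is a set of pairwise adjacent vertices (the empty set is allowed). A graph is $C_4$-free if it does not contain the cycle $C_4$ on four vertices as an induced subgraph. A vertex of a graph is bisimplicial if the set of its neighbors (in that graph) can be expressed as the union of two cliques. For positive integers $s,t$, a graph $G$ is $(s,t)$-splittable if $V(G)$ can be partitioned into two sets $S$ and $T$ such that $\chi(G[S])\ge s$ and $\chi(G[T])\ge t$. -}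

module Defs where

open import Data.Nat.Base using (ℕ; zero; suc; _≤_; _≥_; z≤n; s≤s; _%_)
open import Data.Nat.Properties as ℕ using (m≤n⇒m<n∨m≡n)
open import Data.Fin.Base using (Fin; zero; suc; toℕ)
open import Data.Fin.Properties as Fin using (all?; any?)
open import Data.Fin.Subset
  using (Subset; inside; outside; _∈_; _∪_; _∩_; ∣_∣; Nonempty; Empty; ⊤)
  renaming (⊥ to ∅)
open import Data.Fin.Subset.Properties using (_∈?_; anySubset?; ∉⊥; ∣⊥∣≡0; ∣p∣≤n)
open import Data.Vec.Base using (Vec; []; _∷_; lookup; tabulate; here; there)
open import Data.Vec.Properties using (lookup∘tabulate)
open import Data.Product.Base using (∃; ∃₂; _×_; _,_; proj₁; proj₂)
open import Data.Sum.Base using (_⊎_; inj₁; inj₂; swap)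
open import Function.Base using (_∘_; id)
open import Function.Bundles using (_⇔_)
open import Function.Definitions using (Injective)
open import Level using (0ℓ)
open import Relation.Binary.Core using (Rel)
open import Relation.Binary.Definitions using (Decidable; Symmetric; Irreflexive)
open import Relation.Binary.PropositionalEquality
  using (_≡_; _≢_; refl; cong; subst₂)
open import Relation.Nullary
  using (Dec; yes; no; ¬_; ¬?; contradiction; _×-dec_; _⊎-dec_; _→-dec_)
open import Relation.Nullary.Decidable using (map′)
import Relation.Unary as U

------------------------------------------------------------------------
-- Finite simple graphs

record Graph (n : ℕ) : Set₁ where
  infix 4 _~_ _~?_
  field
    _~_      : Rel (Fin n) 0ℓ
    _~?_     : Decidable _~_
    ~-sym    : Symmetric _~_
    ~-irrefl : Irreflexive _≡_ _~_

-- The increasing enumeration of the elements of a subset; the three lemmas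
-- below say that it is a bijection from Fin ∣ A ∣ onto A.

element : ∀ {n} (A : Subset n) → Fin ∣ A ∣ → Fin n
element (inside  ∷ A) zero    = zero
element (inside  ∷ A) (suc i) = suc (element A i)
element (outside ∷ A) i       = suc (element A i)

element-∈ : ∀ {n} (A : Subset n) i → element A i ∈ A
element-∈ (inside  ∷ A) zero    = here
element-∈ (inside  ∷ A) (suc i) = there (element-∈ A i)
element-∈ (outside ∷ A) i       = there (element-∈ A i)

element-injective : ∀ {n} (A : Subset n) → Injective _≡_ _≡_ (element A)
element-injective (inside  ∷ A) {zero}  {zero}  eq = refl
element-injective (inside  ∷ A) {suc i} {suc j} eq =
  cong suc (element-injective A (Fin.suc-injective eq))
element-injective (outside ∷ A) eq = element-injective A (Fin.suc-injective eq)

element-surjective : ∀ {n} (A : Subset n) {x} → x ∈ A → ∃ λ i → element A i ≡ x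
element-surjective (inside ∷ A) here = zero , refl
element-surjective (inside ∷ A) (there x∈A) with element-surjective A x∈A
... | i , eq = suc i , cong suc eq
element-surjective (outside ∷ A) (there x∈A) with element-surjective A x∈A
... | i , eq = i , cong suc eq

-- The induced subgraph G[A], with its vertices relabelled by Fin ∣ A ∣.

_[_] : ∀ {n} → Graph n → (A : Subset n) → Graph ∣ A ∣
G [ A ] = record
  { _~_      = λ i j → element A i ~ element A j
  ; _~?_     = λ i j → element A i ~? element A j
  ; ~-sym    = ~-sym
  ; ~-irrefl = λ i≡j → ~-irrefl (cong (element A) i≡j)
  } where open Graph G

------------------------------------------------------------------------
-- C₄-free graphs

C₄ : Graph 4
C₄ = record
  { _~_      = λ i j → i ↝ j ⊎ j ↝ i
  ; _~?_     = λ i j → (toℕ j ℕ.≟ suc (toℕ i) % 4) ⊎-dec (toℕ i ℕ.≟ suc (toℕ j) % 4)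
  ; ~-sym    = swap
  ; ~-irrefl = λ { {i} refl → λ { (inj₁ p) → ↝-irrefl i p ; (inj₂ p) → ↝-irrefl i p } }
  }
  where
  _↝_ : Rel (Fin 4) 0ℓ
  i ↝ j = toℕ j ≡ suc (toℕ i) % 4

  ↝-irrefl : ∀ i → ¬ (i ↝ i)
  ↝-irrefl zero ()
  ↝-irrefl (suc zero) ()
  ↝-irrefl (suc (suc zero)) ()
  ↝-irrefl (suc (suc (suc zero))) ()

ContainsInduced : ∀ {m n} → Graph m → Graph n → Set
ContainsInduced {m} {n} H G = ∃ λ (f : Fin m → Fin n) →
  Injective _≡_ _≡_ f × (∀ i j → Graph._~_ H i j ⇔ Graph._~_ G (f i) (f j))

C₄-Free : ∀ {n} → Graph n → Set
C₄-Free G = ¬ ContainsInduced C₄ G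

------------------------------------------------------------------------
-- Cliques and colourings

module _ {n} (G : Graph n) where
  open Graph G

  Clique : Subset n → Set
  Clique K = ∀ i j → i ∈ K → j ∈ K → i ≢ j → i ~ j

  Bisimplicial : Fin n → Set
  Bisimplicial v = ∃₂ λ K L → Clique K × Clique L × (∀ u → v ~ u ⇔ u ∈ K ∪ L)

  HasClique : ℕ → Set
  HasClique w = ∃ λ K → Clique K × ∣ K ∣ ≡ w

  Proper : ∀ {k} → (Fin n → Fin k) → Set
  Proper c = ∀ i j → i ~ j → c i ≢ c j

  Colourable : ℕ → Set
  Colourable k = ∃ λ (c : Fin n → Fin k) → Proper c

------------------------------------------------------------------------
-- The clique number and the chromatic number

IsGreatest : (ℕ → Set) → ℕ → Set
IsGreatest P m = P m × (∀ k → P k → k ≤ m)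

IsLeast : (ℕ → Set) → ℕ → Set
IsLeast P m = P m × (∀ k → P k → m ≤ k)

greatest : ∀ {P : ℕ → Set} → U.Decidable P → P 0 →
           ∀ b → (∀ k → P k → k ≤ b) → ∃ (IsGreatest P)
greatest P? P0 zero bound = 0 , P0 , bound
greatest P? P0 (suc b) bound with P? (suc b)
... | yes Pb = suc b , Pb , bound
... | no ¬Pb = greatest P? P0 b bound′
  where
  bound′ : ∀ k → _ → k ≤ b
  bound′ k Pk with m≤n⇒m<n∨m≡n (bound k Pk)
  ... | inj₁ (s≤s k≤b) = k≤b
  ... | inj₂ refl      = contradiction Pk ¬Pb

least : ∀ {P : ℕ → Set} → U.Decidable P → ∀ b → P b → ∃ (IsLeast P)
least P? zero P0 = 0 , P0 , λ _ _ → z≤n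
least {P} P? (suc b) Pb with P? 0
... | yes P0 = 0 , P0 , λ _ _ → z≤n
... | no ¬P0 with least (P? ∘ suc) b Pb
...   | m , Pm , min = suc m , Pm , min′
  where
  min′ : ∀ k → P k → suc m ≤ k
  min′ zero    P0 = contradiction P0 ¬P0
  min′ (suc k) Pk = s≤s (min k Pk)

anyVec? : ∀ {k} n {P : Vec (Fin k) n → Set} → U.Decidable P → Dec (∃ P)
anyVec? zero    P? = map′ ([] ,_) (λ { ([] , p) → p }) (P? [])
anyVec? (suc n) P? =
  map′ (λ { (x , xs , p) → x ∷ xs , p }) (λ { (x ∷ xs , p) → x , xs , p })
       (any? λ x → anyVec? n (λ xs → P? (x ∷ xs)))

module _ {n} (G : Graph n) where
  open Graph G

  clique? : U.Decidable (Clique G)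
  clique? K = all? λ i → all? λ j →
    (i ∈? K) →-dec ((j ∈? K) →-dec (¬? (i Fin.≟ j) →-dec (i ~? j)))

  hasClique? : U.Decidable (HasClique G)
  hasClique? w = anySubset? λ K → clique? K ×-dec (∣ K ∣ ℕ.≟ w)

  proper? : ∀ {k} (c : Fin n → Fin k) → Dec (Proper G c)
  proper? c = all? λ i → all? λ j → (i ~? j) →-dec ¬? (c i Fin.≟ c j)

  colourable? : U.Decidable (Colourable G)
  colourable? k = map′
    (λ { (v , p) → lookup v , p })
    (λ { (c , p) → tabulate c , λ i j i~j eq → p i j i~j
         (subst₂ _≡_ (lookup∘tabulate c i) (lookup∘tabulate c j) eq) })
    (anyVec? n (λ v → proper? (lookup v)))

  cliqueNumber : ∃ (IsGreatest (HasClique G))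
  cliqueNumber = greatest hasClique?
    (∅ , (λ i j i∈∅ → contradiction i∈∅ ∉⊥) , ∣⊥∣≡0 n)
    n (λ { _ (K , _ , refl) → ∣p∣≤n K })

  chromaticNumber : ∃ (IsLeast (Colourable G))
  chromaticNumber = least colourable? n (id , λ i j i~j i≡j → ~-irrefl i≡j i~j)

  ω : ℕ
  ω = proj₁ cliqueNumber

  χ : ℕ
  χ = proj₁ chromaticNumber

------------------------------------------------------------------------
-- Splittability

Splittable : ∀ {n} → ℕ → ℕ → Graph n → Set
Splittable s t G = ∃₂ λ S T →
  S ∪ T ≡ ⊤ × Empty (S ∩ T) × χ (G [ S ]) ≥ s × χ (G [ T ]) ≥ t

{-# OPTIONS --safe #-}

-- Pass to a vertex set B minimal with G[B] not (s + t − 2)-colourable, and let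
-- v be bisimplicial in G[B] with neighbourhood K ∪ L.  Every one of s + t − 2
-- colours must occur around v, so by symmetry ∣ K ∣ ≥ s − 1.  By C₄-freeness
-- the neighbourhoods in L of the vertices of K form a chain; let x ∈ K have the
-- least one, and let A ⊆ K ∪ {v} contain v and x, with ∣ A ∣ = s.  Then A
-- has chromatic number s; suppose that B ─ A were (t − 1)-colourable.  The
-- set Q of v, K and the vertices of L complete to K is a clique, so it has at
-- most s + t − 2 vertices and some colour i does not occur in Q ─ A.  The
-- vertices of colour i in N(v) ─ A then form a stable set in L anticomplete
-- to x.  Moving them to the colour class of x in a colouring of A - v, and
-- giving v the colour i, colours B with (s − 1) + (t − 1) colours.

module Submission where

open import Defs
open import Data.Nat.Base using (ℕ; _+_; _∸_; _≤_; _<_; zero; suc; z≤n; s≤s; s≤s⁻¹)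
open import Data.Fin.Subset
  using (Subset; Nonempty; Empty; inside; outside; _∈_; _∉_; _⊆_; _⊂_; _∪_; _─_; _-_; ∁; ⁅_⁆;
         ∣_∣; ⊤)
open import Data.Product.Base using (∃; _×_; _,_; proj₁; proj₂)
open import Relation.Binary.PropositionalEquality
  using (_≡_; _≢_; refl; sym; trans; cong; cong₂; subst)
open import Data.Nat.Properties as ℕ
  using (≤-trans; ≤-<-trans; <-≤-trans; ≰⇒>; ≮⇒≥; <⇒≱; m≤n⇒m<n∨m≡n)
open import Data.Fin.Base using (Fin; zero; suc; toℕ; fromℕ<; inject≤)
open import Data.Fin.Properties as Fin
  using (all?; any?; toℕ<n; toℕ-injective; fromℕ<-injective; inject≤-injective; injective⇒≤)
open import Data.Fin.Subset.Properties
open import Data.Fin.Subset.Induction using (⊂-wellFounded; Acc; acc)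
open import Data.List.Base using (filter; allFin)
open import Data.List.Extrema ℕ.≤-totalOrder using (argmin; argmin-all; f[argmin]≤f[xs])
open import Data.List.Membership.Propositional.Properties using (∈-filter⁺; ∈-allFin)
open import Data.List.Relation.Unary.All as All using ()
open import Data.List.Relation.Unary.All.Properties using (all-filter)
open import Data.Sum.Base using (_⊎_; inj₁; inj₂; [_,_]′)
open import Data.Vec.Base using ([]; _∷_; here; there; lookup; tabulate)
open import Data.Vec.Properties using (lookup∘tabulate; []=⇒lookup; lookup⇒[]=)
open import Function.Base using (_∘_; id; case_of_)
open import Function.Bundles using (_⇔_; mk⇔; Equivalence)
open import Relation.Nullary
  using (Dec; yes; no; ¬_; does; ¬?; contradiction; _×-dec_; _⊎-dec_; _→-dec_)
open import Relation.Nullary.Decidable using (map′; decidable-stable; dec-true)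
import Relation.Unary as U

-- Cardinalities of finite sets.

∣p∣+∣q─p∣≡∣p∪q∣ : ∀ {n} (p q : Subset n) → ∣ p ∣ + ∣ q ─ p ∣ ≡ ∣ p ∪ q ∣
∣p∣+∣q─p∣≡∣p∪q∣ []            []            = refl
∣p∣+∣q─p∣≡∣p∪q∣ (inside  ∷ p) (_ ∷ q)       = cong suc (∣p∣+∣q─p∣≡∣p∪q∣ p q)
∣p∣+∣q─p∣≡∣p∪q∣ (outside ∷ p) (inside ∷ q)  =
  trans (ℕ.+-suc ∣ p ∣ ∣ q ─ p ∣) (cong suc (∣p∣+∣q─p∣≡∣p∪q∣ p q))
∣p∣+∣q─p∣≡∣p∪q∣ (outside ∷ p) (outside ∷ q) = ∣p∣+∣q─p∣≡∣p∪q∣ p q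

∣p∪q∣≤∣p∣+∣q∣ : ∀ {n} (p q : Subset n) → ∣ p ∪ q ∣ ≤ ∣ p ∣ + ∣ q ∣
∣p∪q∣≤∣p∣+∣q∣ p q = subst (_≤ ∣ p ∣ + ∣ q ∣) (∣p∣+∣q─p∣≡∣p∪q∣ p q)
  (ℕ.+-monoʳ-≤ ∣ p ∣ (∣p─q∣≤∣p∣ q p))

p⊆q⇒∣p∣+∣q─p∣≤∣q∣ : ∀ {n} {p q : Subset n} → p ⊆ q → ∣ p ∣ + ∣ q ─ p ∣ ≤ ∣ q ∣
p⊆q⇒∣p∣+∣q─p∣≤∣q∣ {p = p} {q} p⊆q = subst (_≤ ∣ q ∣) (sym (∣p∣+∣q─p∣≡∣p∪q∣ p q))
  (p⊆q⇒∣p∣≤∣q∣ ([ p⊆q , id ]′ ∘ x∈p∪q⁻ p q))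

x∈p─q⇒x∉q : ∀ {n} (p q : Subset n) {x} → x ∈ p ─ q → x ∉ q
x∈p─q⇒x∉q (_ ∷ p) (_ ∷ q)       (there x∈p─q) (there x∈q) = x∈p─q⇒x∉q p q x∈p─q x∈q
x∈p─q⇒x∉q (_ ∷ p) (inside ∷ q) () here

-- An element of `q` outside `p` is dropped as long as enough others remain; once `m` equals the
-- size of what is left of `q`, all of it is taken.
⊆-interpolate : ∀ {n} {p q : Subset n} {m} → p ⊆ q → ∣ p ∣ ≤ m → m ≤ ∣ q ∣ →
                ∃ λ r → p ⊆ r × r ⊆ q × ∣ r ∣ ≡ m
⊆-interpolate {p = []} {[]} p⊆q _ z≤n = [] , id , id , refl
⊆-interpolate {p = inside ∷ p} {outside ∷ q} p⊆q _ _ = case p⊆q here of λ ()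
⊆-interpolate {p = inside ∷ p} {inside ∷ q} p⊆q (s≤s p≤m) (s≤s m≤q)
  with r , p⊆r , r⊆q , refl ← ⊆-interpolate (drop-∷-⊆ p⊆q) p≤m m≤q =
  inside ∷ r , in⊆in p⊆r , in⊆in r⊆q , refl
⊆-interpolate {p = outside ∷ p} {outside ∷ q} p⊆q p≤m m≤q
  with r , p⊆r , r⊆q , refl ← ⊆-interpolate (drop-∷-⊆ p⊆q) p≤m m≤q =
  outside ∷ r , out⊆ p⊆r , out⊆ r⊆q , refl
⊆-interpolate {p = outside ∷ p} {inside ∷ q} p⊆q p≤m m≤1+q with m≤n⇒m<n∨m≡n m≤1+q
... | inj₂ refl = inside ∷ q , p⊆q , id , refl
... | inj₁ (s≤s m≤q)
  with r , p⊆r , r⊆q , refl ← ⊆-interpolate (drop-∷-⊆ p⊆q) p≤m m≤q =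
  outside ∷ r , out⊆ p⊆r , out⊆ r⊆q , refl

-- Decidable subsets, minimisers and ranks.

subset : ∀ {n} {P : Fin n → Set} → U.Decidable P → Subset n
subset P? = tabulate (does ∘ P?)

subset⁺ : ∀ {n} {P : Fin n → Set} (P? : U.Decidable P) {x} → P x → x ∈ subset P?
subset⁺ P? {x} Px = lookup⇒[]= x _ (trans (lookup∘tabulate (does ∘ P?) x) (dec-true (P? x) Px))

subset⁻ : ∀ {n} {P : Fin n → Set} (P? : U.Decidable P) {x} → x ∈ subset P? → P x
subset⁻ P? {x} x∈ with P? x | trans (sym (lookup∘tabulate (does ∘ P?) x)) ([]=⇒lookup x∈)
... | yes Px | _ = Px
... | no _   | ()

∃-minimiser : ∀ {n} (f : Fin n → ℕ) {p : Subset n} → Nonempty p →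
              ∃ λ x → x ∈ p × (∀ {y} → y ∈ p → f x ≤ f y)
∃-minimiser {n} f {p} (x₀ , x₀∈p) =
  argmin f x₀ xs ,
  argmin-all f x₀∈p (all-filter (_∈? p) (allFin n)) ,
  λ {y} y∈p → All.lookup (f[argmin]≤f[xs] x₀ xs) (∈-filter⁺ (_∈? p) (∈-allFin y) y∈p)
  where xs = filter (_∈? p) (allFin n)

-- Counts the elements of `p` strictly below the given one. On `p` it inverts `element p`; being
-- total, it can serve directly as a colouring in which each vertex of `p` has a colour of its own.
rank : ∀ {n} → Subset n → Fin n → ℕ
rank (_       ∷ p) zero    = 0
rank (inside  ∷ p) (suc x) = suc (rank p x)
rank (outside ∷ p) (suc x) = rank p x

rank<∣p∣ : ∀ {n} {p : Subset n} {x} → x ∈ p → rank p x < ∣ p ∣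
rank<∣p∣ here = s≤s z≤n
rank<∣p∣ {p = inside  ∷ p} (there x∈p) = s≤s (rank<∣p∣ x∈p)
rank<∣p∣ {p = outside ∷ p} (there x∈p) = rank<∣p∣ x∈p

rank-injective : ∀ {n} {p : Subset n} {x y} → x ∈ p → y ∈ p → rank p x ≡ rank p y → x ≡ y
rank-injective here here _ = refl
rank-injective {p = inside  ∷ p} (there x∈p) (there y∈p) eq =
  cong suc (rank-injective x∈p y∈p (ℕ.suc-injective eq))
rank-injective {p = outside ∷ p} (there x∈p) (there y∈p) eq =
  cong suc (rank-injective x∈p y∈p eq)

-- Counting the colours on a set.

surjection⇒≤∣p∣ : ∀ {n} {p : Subset n} (c : Fin n → ℕ) {m} →
                 (∀ (i : Fin m) → ∃ λ x → x ∈ p × c x ≡ toℕ i) → m ≤ ∣ p ∣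
surjection⇒≤∣p∣ {p = p} c onto = injective⇒≤ {f = f} f-injective
  where
  preimage = proj₁ ∘ onto
  preimage∈p = proj₁ ∘ proj₂ ∘ onto
  f = λ i → fromℕ< (rank<∣p∣ (preimage∈p i))
  f-injective : ∀ {i j} → f i ≡ f j → i ≡ j
  f-injective {i} {j} eq = toℕ-injective
    (trans (sym (proj₂ (proj₂ (onto i))))
    (trans (cong c (rank-injective (preimage∈p i) (preimage∈p j) (fromℕ<-injective _ _ _ _ eq)))
           (proj₂ (proj₂ (onto j)))))

missing-colour : ∀ {n} (p : Subset n) (c : Fin n → ℕ) {m} → ∣ p ∣ < m →
                 ∃ λ i → i < m × (∀ {x} → x ∈ p → c x ≢ i)
missing-colour p c {m} ∣p∣<m
  with any? (λ (i : Fin m) → all? λ x → (x ∈? p) →-dec ¬? (c x ℕ.≟ toℕ i))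
... | yes (i , missed) = toℕ i , toℕ<n i , λ {x} → missed x
... | no all-hit = contradiction (surjection⇒≤∣p∣ c hit) (<⇒≱ ∣p∣<m)
  where
  hit : ∀ i → ∃ λ x → x ∈ p × c x ≡ toℕ i
  hit i with any? (λ x → (x ∈? p) ×-dec (c x ℕ.≟ toℕ i))
  ... | yes found = found
  ... | no ¬found = contradiction (i , λ x x∈p eq → ¬found (x , x∈p , eq)) all-hit

-- Colourings of vertex sets and critical sets.

module _ {n} (G : Graph n) where
  open Graph G

  -- Colours are given to all vertices but constrained only on `B`, so passing to subsets and
  -- recolouring need no relabelling of vertices.
  ColourableOn : Subset n → ℕ → Set
  ColourableOn B m = ∃ λ (c : Fin n → ℕ) →
    (∀ {x} → x ∈ B → c x < m) × (∀ {x y} → x ∈ B → y ∈ B → x ~ y → c x ≢ c y)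

  ColourableOn⇒Colourable : ∀ {B m} → ColourableOn B m → Colourable (G [ B ]) m
  ColourableOn⇒Colourable {B} (c , c< , proper) =
    (λ i → fromℕ< (c< (element-∈ B i))) ,
    λ i j i~j eq → proper (element-∈ B i) (element-∈ B j) i~j (fromℕ<-injective _ _ _ _ eq)

  Colourable⇒ColourableOn : ∀ {B m} → Colourable (G [ B ]) m → ColourableOn B m
  Colourable⇒ColourableOn {B} {m} (c , proper) = c′ , c′< , proper′
    where
    c′ : Fin n → ℕ
    c′ x with x ∈? B
    ... | yes x∈B = toℕ (c (proj₁ (element-surjective B x∈B)))
    ... | no  _   = 0
    c′< : ∀ {x} → x ∈ B → c′ x < m
    c′< {x} x∈B with x ∈? B
    ... | yes _   = toℕ<n _
    ... | no  x∉B = contradiction x∈B x∉B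
    proper′ : ∀ {x y} → x ∈ B → y ∈ B → x ~ y → c′ x ≢ c′ y
    proper′ {x} {y} x∈B y∈B x~y eq with x ∈? B | y ∈? B
    ... | no x∉B | _      = x∉B x∈B
    ... | _      | no y∉B = y∉B y∈B
    ... | yes p  | yes q
      with i , refl ← element-surjective B p | j , refl ← element-surjective B q =
      proper i j x~y (toℕ-injective eq)

  colourableOn? : ∀ B m → Dec (ColourableOn B m)
  colourableOn? B m = map′ Colourable⇒ColourableOn ColourableOn⇒Colourable (colourable? (G [ B ]) m)

  ColourableOn-⊆ : ∀ {B C m} → B ⊆ C → ColourableOn C m → ColourableOn B m
  ColourableOn-⊆ B⊆C (c , c< , proper) =
    c , c< ∘ B⊆C , λ x∈B y∈B → proper (B⊆C x∈B) (B⊆C y∈B)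

  -- The second palette is shifted past the first, so no edge between the two sets is monochromatic.
  -- A vertex in both sets keeps its first colour.
  ColourableOn-∪ : ∀ {B C l m} → ColourableOn B l → ColourableOn C m →
                   ColourableOn (B ∪ C) (l + m)
  ColourableOn-∪ {B} {C} {l} {m} (b , b< , b-proper) (c , c< , c-proper) = d , d< , d-proper
    where
    d : Fin n → ℕ
    d x with x ∈? B
    ... | yes _ = b x
    ... | no  _ = l + c x
    ∈C : ∀ {x} → x ∈ B ∪ C → x ∉ B → x ∈ C
    ∈C x∈ x∉B = [ (λ x∈B → contradiction x∈B x∉B) , id ]′ (x∈p∪q⁻ B C x∈)
    d< : ∀ {x} → x ∈ B ∪ C → d x < l + m
    d< {x} x∈ with x ∈? B
    ... | yes x∈B = <-≤-trans (b< x∈B) (ℕ.m≤m+n l m)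
    ... | no  x∉B = ℕ.+-monoʳ-< l (c< (∈C x∈ x∉B))
    d-proper : ∀ {x y} → x ∈ B ∪ C → y ∈ B ∪ C → x ~ y → d x ≢ d y
    d-proper {x} {y} x∈ y∈ x~y eq with x ∈? B | y ∈? B
    ... | yes x∈B | yes y∈B = b-proper x∈B y∈B x~y eq
    ... | yes x∈B | no  _   = <⇒≱ (b< x∈B) (subst (l ≤_) (sym eq) (ℕ.m≤m+n l _))
    ... | no  _   | yes y∈B = <⇒≱ (b< y∈B) (subst (l ≤_) eq (ℕ.m≤m+n l _))
    ... | no  x∉B | no  y∉B = c-proper (∈C x∈ x∉B) (∈C y∈ y∉B) x~y (ℕ.+-cancelˡ-≡ l _ _ eq)

  -- The common step of all recolourings below: `I` receives colour `i`, overriding any colour it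
  -- had. It serves to insert `v` and to enlarge the class of `x`.
  extend-colour-class : ∀ {D I m} (c : Fin n → ℕ) {i} →
    (∀ {x} → x ∈ D → c x < m) → (∀ {x y} → x ∈ D → y ∈ D → x ~ y → c x ≢ c y) →
    i < m →
    (∀ {u w} → u ∈ I → w ∈ I → ¬ u ~ w) →
    (∀ {u w} → u ∈ I → w ∈ D → u ~ w → c w ≢ i) →
    ColourableOn (D ∪ I) m
  extend-colour-class {D} {I} {m} c {i} c< proper i<m stable free = d , d< , d-proper
    where
    d : Fin n → ℕ
    d x with x ∈? I
    ... | yes _ = i
    ... | no  _ = c x
    ∈D : ∀ {x} → x ∈ D ∪ I → x ∉ I → x ∈ D
    ∈D x∈ x∉I = [ id , (λ x∈I → contradiction x∈I x∉I) ]′ (x∈p∪q⁻ D I x∈)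
    d< : ∀ {x} → x ∈ D ∪ I → d x < m
    d< {x} x∈ with x ∈? I
    ... | yes _   = i<m
    ... | no  x∉I = c< (∈D x∈ x∉I)
    d-proper : ∀ {x y} → x ∈ D ∪ I → y ∈ D ∪ I → x ~ y → d x ≢ d y
    d-proper {x} {y} x∈ y∈ x~y eq with x ∈? I | y ∈? I
    ... | yes x∈I | yes y∈I = stable x∈I y∈I x~y
    ... | yes x∈I | no  y∉I = free x∈I (∈D y∈ y∉I) x~y (sym eq)
    ... | no  x∉I | yes y∈I = free y∈I (∈D x∈ x∉I) (~-sym x~y) eq
    ... | no  x∉I | no  y∉I = proper (∈D x∈ x∉I) (∈D y∈ y∉I) x~y eq

  -- Delete vertices while the rest stays uncolourable; strict inclusion is well founded.
  ∃-critical : ∀ {m} (B : Subset n) → ¬ ColourableOn B m →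
               ∃ λ C → ¬ ColourableOn C m × (∀ {x} → x ∈ C → ColourableOn (C - x) m)
  ∃-critical {m} B = go B (⊂-wellFounded B)
    where
    go : ∀ B → Acc _⊂_ B → ¬ ColourableOn B m →
         ∃ λ C → ¬ ColourableOn C m × (∀ {x} → x ∈ C → ColourableOn (C - x) m)
    go B (acc rec) ¬col with any? (λ x → (x ∈? B) ×-dec ¬? (colourableOn? (B - x) m))
    ... | yes (x , x∈B , ¬col′) = go (B - x) (rec (x∈p⇒p-x⊂p x∈B)) ¬col′
    ... | no  ∄x = B , ¬col , λ {x} x∈B →
      decidable-stable (colourableOn? (B - x) m) (λ ¬col′ → ∄x (x , x∈B , ¬col′))

  -- Otherwise some colour of `B - v` is absent from `N`, hence from all neighbours of `v` in `B`,
  -- and `v` can take it.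
  critical-degree : ∀ {B m v} (N : Subset n) → ¬ ColourableOn B m → ColourableOn (B - v) m →
                    (∀ {u} → u ∈ B → v ~ u → u ∈ N) → m ≤ ∣ N ∣
  critical-degree {B} {m} {v} N ¬col (c , c< , proper) nbr = ≮⇒≥ λ ∣N∣<m →
    let i , i<m , missed = missing-colour N c ∣N∣<m in
    ¬col (ColourableOn-⊆ cover
      (extend-colour-class {B - v} {⁅ v ⁆} c c< proper i<m
        (λ u∈ w∈ → ~-irrefl (trans (x∈⁅y⁆⇒x≡y v u∈) (sym (x∈⁅y⁆⇒x≡y v w∈))))
        (λ u∈ w∈ u~w → missed (nbr (p─q⊆p B ⁅ v ⁆ w∈) (subst (_~ _) (x∈⁅y⁆⇒x≡y v u∈) u~w)))))
    where
    cover : B ⊆ (B - v) ∪ ⁅ v ⁆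
    cover {x} x∈B with x Fin.≟ v
    ... | yes refl = x∈p∪q⁺ (inj₂ (x∈⁅x⁆ v))
    ... | no  x≢v  = x∈p∪q⁺ (inj₁ (x∈p∧x≢y⇒x∈p-y x∈B x≢v))

  ¬ColourableOn⇒χ> : ∀ {B m} → ¬ ColourableOn B m → m < χ (G [ B ])
  ¬ColourableOn⇒χ> {B} {m} ¬col = ≰⇒> λ χ≤m →
    let c , proper = proj₁ (proj₂ (chromaticNumber (G [ B ]))) in
    ¬col (Colourable⇒ColourableOn
      ((λ i → inject≤ (c i) χ≤m) , λ i j i~j eq → proper i j i~j (inject≤-injective _ _ _ _ eq)))

  Clique⇒∣K∣≤χ : ∀ {K} → Clique G K → ∣ K ∣ ≤ χ (G [ K ])
  Clique⇒∣K∣≤χ {K} clique =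
    let c , proper = proj₁ (proj₂ (chromaticNumber (G [ K ]))) in
    injective⇒≤ {f = c} λ {i} {j} eq → case i Fin.≟ j of λ where
      (yes i≡j) → i≡j
      (no  i≢j) → contradiction eq (proper i j
        (clique _ _ (element-∈ K i) (element-∈ K j) (i≢j ∘ element-injective K)))

  -- Nested neighbourhoods in C₄-free graphs.

  C₄-free⇒chord : C₄-Free G → ∀ {a b c d} → a ~ b → b ~ c → c ~ d → d ~ a →
                  a ≢ c → b ≢ d → ¬ a ~ c → b ~ d
  -- Were the diagonal `b`, `d` missing too, the four vertices would induce a C₄.
  C₄-free⇒chord free {a} {b} {c} {d} ab bc cd da a≢c b≢d ¬ac =
    decidable-stable (b ~? d) λ ¬bd → free (f , f-injective , f-edges ¬bd)
    where
    f : Fin 4 → Fin n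
    f = lookup (a ∷ b ∷ c ∷ d ∷ [])
    pattern 0F = zero
    pattern 1F = suc zero
    pattern 2F = suc (suc zero)
    pattern 3F = suc (suc (suc zero))
    ≢ : ∀ {x y} → x ~ y → x ≢ y
    ≢ x~y x≡y = ~-irrefl x≡y x~y
    f-injective : ∀ {i j} → f i ≡ f j → i ≡ j
    f-injective {0F} {0F} _  = refl
    f-injective {0F} {1F} eq = contradiction eq (≢ ab)
    f-injective {0F} {2F} eq = contradiction eq a≢c
    f-injective {0F} {3F} eq = contradiction (sym eq) (≢ da)
    f-injective {1F} {0F} eq = contradiction (sym eq) (≢ ab)
    f-injective {1F} {1F} _  = refl
    f-injective {1F} {2F} eq = contradiction eq (≢ bc)
    f-injective {1F} {3F} eq = contradiction eq b≢d
    f-injective {2F} {0F} eq = contradiction (sym eq) a≢c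
    f-injective {2F} {1F} eq = contradiction (sym eq) (≢ bc)
    f-injective {2F} {2F} _  = refl
    f-injective {2F} {3F} eq = contradiction eq (≢ cd)
    f-injective {3F} {0F} eq = contradiction eq (≢ da)
    f-injective {3F} {1F} eq = contradiction (sym eq) b≢d
    f-injective {3F} {2F} eq = contradiction (sym eq) (≢ cd)
    f-injective {3F} {3F} _  = refl
    edge : ∀ {i j} → Graph._~_ C₄ i j → f i ~ f j → Graph._~_ C₄ i j ⇔ f i ~ f j
    edge p q = mk⇔ (λ _ → q) (λ _ → p)
    non-edge : ∀ {i j} → ¬ Graph._~_ C₄ i j → ¬ f i ~ f j → Graph._~_ C₄ i j ⇔ f i ~ f j
    non-edge p q = mk⇔ (λ x → contradiction x p) (λ x → contradiction x q)
    loop : ∀ i → Graph._~_ C₄ i i ⇔ f i ~ f i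
    loop i = non-edge {i} {i} (Graph.~-irrefl C₄ refl) (~-irrefl refl)
    f-edges : ¬ b ~ d → ∀ i j → Graph._~_ C₄ i j ⇔ f i ~ f j
    f-edges ¬bd 0F 0F = loop 0F
    f-edges ¬bd 0F 1F = edge {0F} {1F} (inj₁ refl) ab
    f-edges ¬bd 0F 2F = non-edge {0F} {2F} (λ { (inj₁ ()) ; (inj₂ ()) }) ¬ac
    f-edges ¬bd 0F 3F = edge {0F} {3F} (inj₂ refl) (~-sym da)
    f-edges ¬bd 1F 0F = edge {1F} {0F} (inj₂ refl) (~-sym ab)
    f-edges ¬bd 1F 1F = loop 1F
    f-edges ¬bd 1F 2F = edge {1F} {2F} (inj₁ refl) bc
    f-edges ¬bd 1F 3F = non-edge {1F} {3F} (λ { (inj₁ ()) ; (inj₂ ()) }) ¬bd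
    f-edges ¬bd 2F 0F = non-edge {2F} {0F} (λ { (inj₁ ()) ; (inj₂ ()) }) (¬ac ∘ ~-sym)
    f-edges ¬bd 2F 1F = edge {2F} {1F} (inj₂ refl) (~-sym bc)
    f-edges ¬bd 2F 2F = loop 2F
    f-edges ¬bd 2F 3F = edge {2F} {3F} (inj₁ refl) cd
    f-edges ¬bd 3F 0F = edge {3F} {0F} (inj₁ refl) da
    f-edges ¬bd 3F 1F = non-edge {3F} {1F} (λ { (inj₁ ()) ; (inj₂ ()) }) (¬bd ∘ ~-sym)
    f-edges ¬bd 3F 2F = edge {3F} {2F} (inj₂ refl) (~-sym cd)
    f-edges ¬bd 3F 3F = loop 3F

  -- Take `x` with the fewest neighbours in `L` outside `K`. If `z` missed a neighbour `y` of `x`,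
  -- its neighbourhood there would be properly contained in that of `x`.
  ∃-least-neighbourhood : C₄-Free G → ∀ {K L} → Clique G K → Clique G L → Nonempty K →
    ∃ λ x → x ∈ K × (∀ {y z} → y ∈ L → y ∉ K → x ~ y → z ∈ K → z ~ y)
  ∃-least-neighbourhood free {K} {L} cliqueK cliqueL K≠∅ =
    let x , x∈K , least-x = ∃-minimiser (∣_∣ ∘ N) K≠∅ in
    x , x∈K , λ {y} {z} y∈L y∉K x~y z∈K → decidable-stable (z ~? y) λ ¬z~y →
      <⇒≱ (p⊂q⇒∣p∣<∣q∣ (Nz⊆Nx x∈K y∈L y∉K x~y z∈K ¬z~y ,
              y , subset⁺ (N? x) (y∈L , y∉K , x~y) , ¬z~y ∘ proj₂ ∘ proj₂ ∘ subset⁻ (N? z)))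
          (least-x z∈K)
    where
    -- The cliques may overlap; leaving out `K` keeps the vertices of the 4-cycle below distinct.
    N? : ∀ x → U.Decidable (λ y → y ∈ L × y ∉ K × x ~ y)
    N? x y = (y ∈? L) ×-dec (¬? (y ∈? K) ×-dec (x ~? y))
    N : Fin n → Subset n
    N x = subset (N? x)
    Nz⊆Nx : ∀ {x y z} → x ∈ K → y ∈ L → y ∉ K → x ~ y → z ∈ K → ¬ z ~ y → N z ⊆ N x
    -- The 4-cycle `z`, `w`, `y`, `x` lacks the diagonal from `z` to `y`, so `w` and `x` are
    -- adjacent.
    Nz⊆Nx {x} {y} {z} x∈K y∈L y∉K x~y z∈K ¬z~y {w} w∈Nz
      with w∈L , w∉K , z~w ← subset⁻ (N? z) w∈Nz
      = subset⁺ (N? x) (w∈L , w∉K , ~-sym (C₄-free⇒chord free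
          z~w
          (cliqueL w y w∈L y∈L (λ { refl → ¬z~y z~w }))
          (~-sym x~y)
          (cliqueK x z x∈K z∈K (λ { refl → ¬z~y x~y }))
          (λ { refl → y∉K z∈K })
          (λ { refl → w∉K x∈K })
          ¬z~y))

  -- Splitting at a bisimplicial vertex.

  module _ {v : Fin n} {K L : Subset n} (cliqueK : Clique G K) (cliqueL : Clique G L)
           (v~K : ∀ {u} → u ∈ K → v ~ u) (v~L : ∀ {u} → u ∈ L → v ~ u) where

    K∪v : Subset n
    K∪v = ⁅ v ⁆ ∪ K

    v∉K : v ∉ K
    v∉K = ~-irrefl refl ∘ v~K

    Q? : U.Decidable (λ y → y ≡ v ⊎ y ∈ K ⊎ (y ∈ L × (∀ z → z ∈ K → z ~ y)))
    Q? y = (y Fin.≟ v) ⊎-dec ((y ∈? K) ⊎-dec ((y ∈? L) ×-dec (all? λ z → (z ∈? K) →-dec (z ~? y))))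

    Q : Subset n
    Q = subset Q?

    cliqueQ : Clique G Q
    cliqueQ y z y∈Q z∈Q y≢z with subset⁻ Q? y∈Q | subset⁻ Q? z∈Q
    ... | inj₁ refl             | inj₁ refl             = contradiction refl y≢z
    ... | inj₁ refl             | inj₂ (inj₁ z∈K)       = v~K z∈K
    ... | inj₁ refl             | inj₂ (inj₂ (z∈L , _)) = v~L z∈L
    ... | inj₂ (inj₁ y∈K)       | inj₁ refl             = ~-sym (v~K y∈K)
    ... | inj₂ (inj₁ y∈K)       | inj₂ (inj₁ z∈K)       = cliqueK y z y∈K z∈K y≢z
    ... | inj₂ (inj₁ y∈K)       | inj₂ (inj₂ (_ , K~z)) = K~z y y∈K
    ... | inj₂ (inj₂ (y∈L , _)) | inj₁ refl             = ~-sym (v~L y∈L)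
    ... | inj₂ (inj₂ (_ , K~y)) | inj₂ (inj₁ z∈K)       = ~-sym (K~y z z∈K)
    ... | inj₂ (inj₂ (y∈L , _)) | inj₂ (inj₂ (z∈L , _)) = cliqueL y z y∈L z∈L y≢z

    K∪v⊆Q : K∪v ⊆ Q
    K∪v⊆Q = [ subset⁺ Q? ∘ inj₁ ∘ x∈⁅y⁆⇒x≡y v , subset⁺ Q? ∘ inj₂ ∘ inj₁ ]′ ∘ x∈p∪q⁻ ⁅ v ⁆ K

    ∣K∣<∣K∪v∣ : ∣ K ∣ < ∣ K∪v ∣
    ∣K∣<∣K∪v∣ = p⊂q⇒∣p∣<∣q∣ (q⊆p∪q ⁅ v ⁆ K , v , x∈p∪q⁺ (inj₁ (x∈⁅x⁆ v)) , v∉K)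

    -- From here on `s` and `t` are one less than in the theorem. The `t` colours would serve `v`
    -- and most of `B ─ A`, and `s` further ones `A - v` and the vertices moved to it.
    remainder-uncolourable : ∀ {s t B A x} → (∀ {Q} → Clique G Q → ∣ Q ∣ ≤ s + t) →
      ¬ ColourableOn B (s + t) → (∀ {u} → u ∈ B → v ~ u → u ∈ K ∪ L) →
      x ∈ K → (∀ {y z} → y ∈ L → y ∉ K → x ~ y → z ∈ K → z ~ y) →
      v ∈ A → x ∈ A → A ⊆ K∪v → ∣ A ∣ ≡ suc s →
      ¬ ColourableOn (B ─ A) t
    remainder-uncolourable {s} {t} {B} {A} {x} small ¬col cover x∈K least-x v∈A x∈A A⊆K∪v ∣A∣≡1+s
                           (c , c< , proper) =
      let i , i<t , missed = missing-colour (Q ─ A) c ∣Q─A∣<t in recolour i i<t missed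
      where
      ∣Q─A∣<t : ∣ Q ─ A ∣ < t
      ∣Q─A∣<t = ℕ.+-cancelˡ-≤ s _ _
        -- `A` takes `suc s` of the at most `s + t` vertices of `Q`.
        (subst (_≤ s + t) (trans (cong (_+ ∣ Q ─ A ∣) ∣A∣≡1+s) (sym (ℕ.+-suc s _)))
          (≤-trans (p⊆q⇒∣p∣+∣q─p∣≤∣q∣ (K∪v⊆Q ∘ A⊆K∪v)) (small cliqueQ)))

      A-v⊆K : A - v ⊆ K
      A-v⊆K {w} w∈A-v with x∈p∪q⁻ ⁅ v ⁆ K (A⊆K∪v (p─q⊆p A ⁅ v ⁆ w∈A-v))
      ... | inj₁ w∈v = contradiction w∈v (x∈p─q⇒x∉q A ⁅ v ⁆ w∈A-v)
      ... | inj₂ w∈K = w∈K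

      x∈A-v : x ∈ A - v
      x∈A-v = x∈p∧x≢y⇒x∈p-y x∈A (λ { refl → v∉K x∈K })

      ∣A-v∣≤s : ∣ A - v ∣ ≤ s
      ∣A-v∣≤s = s≤s⁻¹ (subst (∣ A - v ∣ <_) ∣A∣≡1+s (x∈p⇒∣p-x∣<∣p∣ v∈A))

      rank<s : ∀ {w} → w ∈ A - v → rank (A - v) w < s
      rank<s w∈ = <-≤-trans (rank<∣p∣ w∈) ∣A-v∣≤s

      recolour : ∀ i → i < t → ¬ (∀ {y} → y ∈ Q ─ A → c y ≢ i)
      recolour i i<t missed = ¬col (subst (ColourableOn B) (ℕ.+-comm t s)
        (ColourableOn-⊆ B⊆ (ColourableOn-∪
          (extend-colour-class {(B ─ A) ─ U} {⁅ v ⁆} c (c< ∘ p─q⊆p (B ─ A) U)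
            (λ y∈ z∈ → proper (p─q⊆p (B ─ A) U y∈) (p─q⊆p (B ─ A) U z∈)) i<t
            (λ u∈ w∈ → ~-irrefl (trans (x∈⁅y⁆⇒x≡y v u∈) (sym (x∈⁅y⁆⇒x≡y v w∈))))
            -- A neighbour of `v` of colour `i` outside `A` would lie in `U`, which has been
            -- removed.
            (λ u∈ w∈ u~w cw≡i → x∈p─q⇒x∉q (B ─ A) U w∈ (subset⁺ U?
              (p─q⊆p (B ─ A) U w∈ , subst (_~ _) (x∈⁅y⁆⇒x≡y v u∈) u~w , cw≡i))))
          (extend-colour-class {A - v} {U} (rank (A - v)) rank<s
            (λ y∈ z∈ y~z eq → ~-irrefl (rank-injective y∈ z∈ eq) y~z) (rank<s x∈A-v)
            U-stable
            -- Ranks are distinct on `A - v`, so `x` is the only vertex there whose colour `U`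
            -- shares.
            (λ u∈U w∈A-v u~w eq → x≁U u∈U
              (~-sym (subst (_ ~_) (rank-injective w∈A-v x∈A-v eq) u~w)))))))
        where
        U? : U.Decidable (λ u → u ∈ B ─ A × v ~ u × c u ≡ i)
        U? u = (u ∈? (B ─ A)) ×-dec ((v ~? u) ×-dec (c u ℕ.≟ i))
        U : Subset n
        U = subset U?

        U-stable : ∀ {u w} → u ∈ U → w ∈ U → ¬ u ~ w
        U-stable u∈U w∈U u~w =
          let u∈ , _ , cu≡i = subset⁻ U? u∈U
              w∈ , _ , cw≡i = subset⁻ U? w∈U
          in proper u∈ w∈ u~w (trans cu≡i (sym cw≡i))

        -- Colour `i` avoids `Q ─ A`, so `u` is in `L` but not in `Q`. Adjacency to `x` would make
        -- it complete to `K` by the choice of `x`, and so put it in `Q`.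
        x≁U : ∀ {u} → u ∈ U → ¬ x ~ u
        x≁U {u} u∈U x~u =
          let u∈ , v~u , cu≡i = subset⁻ U? u∈U
              u∉Q = λ u∈Q → missed (x∈p∧x∉q⇒x∈p─q (subset⁺ Q? u∈Q) (x∈p─q⇒x∉q B A u∈)) cu≡i
              u∉K = λ u∈K → u∉Q (inj₂ (inj₁ u∈K))
          in case x∈p∪q⁻ K L (cover (p─q⊆p B A u∈) v~u) of λ where
            (inj₁ u∈K) → u∉K u∈K
            (inj₂ u∈L) → u∉Q (inj₂ (inj₂ (u∈L , λ z → least-x u∈L u∉K x~u)))

        B⊆ : B ⊆ (((B ─ A) ─ U) ∪ ⁅ v ⁆) ∪ ((A - v) ∪ U)
        B⊆ {y} y∈B with y Fin.≟ v | y ∈? A | y ∈? U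
        ... | yes refl | _       | _       = x∈p∪q⁺ (inj₁ (x∈p∪q⁺ (inj₂ (x∈⁅x⁆ v))))
        ... | no y≢v   | yes y∈A | _       =
          x∈p∪q⁺ (inj₂ (x∈p∪q⁺ (inj₁ (x∈p∧x≢y⇒x∈p-y y∈A y≢v))))
        ... | _        | _       | yes y∈U = x∈p∪q⁺ (inj₂ (x∈p∪q⁺ (inj₂ y∈U)))
        ... | _        | no y∉A  | no y∉U  =
          x∈p∪q⁺ (inj₁ (x∈p∪q⁺ (inj₁ (x∈p∧x∉q⇒x∈p─q (x∈p∧x∉q⇒x∈p─q y∈B y∉A) y∉U))))

    -- The parts are `A` and its complement in the whole graph, which contains `B ─ A` and so is not
    -- `t`-colourable either.
    splittable-at-bisimplicial : C₄-Free G → ∀ {s t B} → 1 ≤ s →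
      (∀ {Q} → Clique G Q → ∣ Q ∣ ≤ s + t) →
      ¬ ColourableOn B (s + t) → (∀ {u} → u ∈ B → v ~ u → u ∈ K ∪ L) → s ≤ ∣ K ∣ →
      Splittable (suc s) (suc t) G
    splittable-at-bisimplicial free {s} {t} {B} 1≤s small ¬col cover s≤∣K∣ =
      let x , x∈K , least-x = ∃-least-neighbourhood free cliqueK cliqueL
            (element K (fromℕ< (≤-trans 1≤s s≤∣K∣)) , element-∈ K _)
          -- The required size fits: `v` and `x` make at most two vertices, and `K∪v` has more than
          -- `s`.
          A , vx⊆A , A⊆K∪v , ∣A∣≡1+s = ⊆-interpolate {p = ⁅ v ⁆ ∪ ⁅ x ⁆} {K∪v} {suc s}
            ([ p⊆p∪q K , (λ w∈x → x∈p∪q⁺ (inj₂ (subst (_∈ K) (sym (x∈⁅y⁆⇒x≡y x w∈x)) x∈K))) ]′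
              ∘ x∈p∪q⁻ ⁅ v ⁆ ⁅ x ⁆)
            (≤-trans (∣p∪q∣≤∣p∣+∣q∣ ⁅ v ⁆ ⁅ x ⁆)
              (subst (_≤ suc s) (sym (cong₂ _+_ (∣⁅x⁆∣≡1 v) (∣⁅x⁆∣≡1 x))) (s≤s 1≤s)))
            (≤-<-trans s≤∣K∣ ∣K∣<∣K∪v∣)
      in A , ∁ A , p∪∁p≡⊤ A ,
         (λ (y , y∈) → let y∈A , y∈∁A = x∈p∩q⁻ A (∁ A) y∈ in x∈∁p⇒x∉p y∈∁A y∈A) ,
         subst (_≤ χ (G [ A ])) ∣A∣≡1+s (Clique⇒∣K∣≤χ λ y z y∈A z∈A →
           cliqueQ y z (K∪v⊆Q (A⊆K∪v y∈A)) (K∪v⊆Q (A⊆K∪v z∈A))) ,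
         ¬ColourableOn⇒χ> λ col → remainder-uncolourable small ¬col cover x∈K least-x
           (vx⊆A (p⊆p∪q ⁅ x ⁆ (x∈⁅x⁆ v))) (vx⊆A (q⊆p∪q ⁅ v ⁆ ⁅ x ⁆ (x∈⁅x⁆ x))) A⊆K∪v ∣A∣≡1+s
           (ColourableOn-⊆ (λ y∈B─A → x∉p⇒x∈∁p (x∈p─q⇒x∉q B A y∈B─A)) col)

  -- Symmetry, transfer from induced subgraphs, and the conclusion.

  Splittable-comm : ∀ {s t} → Splittable s t G → Splittable t s G
  Splittable-comm (S , T , S∪T≡⊤ , S∩T≡∅ , χS≥s , χT≥t) =
    T , S , trans (∪-comm T S) S∪T≡⊤ , subst Empty (∩-comm S T) S∩T≡∅ , χT≥t , χS≥s

  -- Carries both cliques back to `G` along `element B`. Their union accounts only for the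
  -- neighbours inside `B`.
  Bisimplicial-[] : ∀ {B : Subset n} {i} →
    Bisimplicial (G [ B ]) i →
    ∃ λ K → ∃ λ L → Clique G K × Clique G L ×
      (∀ {u} → u ∈ K → element B i ~ u) × (∀ {u} → u ∈ L → element B i ~ u) ×
      (∀ {u} → u ∈ B → element B i ~ u → u ∈ K ∪ L)
  Bisimplicial-[] {B} {i} (K , L , cliqueK , cliqueL , nbr) =
    image K , image L , image-clique cliqueK , image-clique cliqueL ,
    nbr-image (x∈p∪q⁺ ∘ inj₁) , nbr-image (x∈p∪q⁺ ∘ inj₂) , cover
    where
    image? : ∀ J → U.Decidable (λ y → ∃ λ j → j ∈ J × element B j ≡ y)
    image? J y = any? λ j → (j ∈? J) ×-dec (element B j Fin.≟ y)
    image : Subset ∣ B ∣ → Subset n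
    image J = subset (image? J)
    image-clique : ∀ {J} → Clique (G [ B ]) J → Clique G (image J)
    image-clique {J} clique y z y∈ z∈ y≢z
      with j , j∈J , refl ← subset⁻ (image? J) y∈ | k , k∈J , refl ← subset⁻ (image? J) z∈ =
      clique j k j∈J k∈J (y≢z ∘ cong (element B))
    nbr-image : ∀ {J} → J ⊆ K ∪ L → ∀ {u} → u ∈ image J → element B i ~ u
    nbr-image {J} J⊆ u∈ with j , j∈J , refl ← subset⁻ (image? J) u∈ =
      Equivalence.from (nbr j) (J⊆ j∈J)
    cover : ∀ {u} → u ∈ B → element B i ~ u → u ∈ image K ∪ image L
    cover u∈B v~u with j , refl ← element-surjective B u∈B
      with x∈p∪q⁻ K L (Equivalence.to (nbr j) v~u)
    ... | inj₁ j∈K = x∈p∪q⁺ (inj₁ (subset⁺ (image? K) (j , j∈K , refl)))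
    ... | inj₂ j∈L = x∈p∪q⁺ (inj₂ (subset⁺ (image? L) (j , j∈L , refl)))

theorem1p4 : ∀ (s t : ℕ) → 2 ≤ s → 2 ≤ t →
    ∀ {n : ℕ} (G : Graph n) → C₄-Free G →
    (∀ (A : Subset n) → Nonempty A → ∃ λ v → Bisimplicial (G [ A ]) v) →
    ω G < χ G → χ G ≡ s + t ∸ 1 →
    Splittable s t G
theorem1p4 (suc s) (suc t) (s≤s 1≤s) (s≤s 1≤t) {n} G free bisimplicial ω<χ χ≡s+1+t =
  -- With both parameters lowered by one, `s + t` is one colour fewer than χ(G).
  let B , ¬col , critical = ∃-critical G ⊤ ⊤-uncolourable
      i , i-bisimplicial = bisimplicial B (nonempty ¬col)
      K , L , cliqueK , cliqueL , v~K , v~L , cover = Bisimplicial-[] G i-bisimplicial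
      s+t≤∣K∣+∣L∣ = ≤-trans
        (critical-degree G (K ∪ L) ¬col (critical (element-∈ B i)) cover) (∣p∪q∣≤∣p∣+∣q∣ K L)
  in case s ℕ.≤? ∣ K ∣ of λ where
    (yes s≤∣K∣) → splittable-at-bisimplicial G cliqueK cliqueL v~K v~L free 1≤s
      small ¬col cover s≤∣K∣
    -- The cliques have at least `s + t` vertices in total, so if `K` has fewer than `s`, then `L`
    -- has at least `t` and the roles are exchanged.
    (no  s≰∣K∣) → Splittable-comm G (splittable-at-bisimplicial G cliqueL cliqueK v~L v~K free 1≤t
      (λ {Q} → subst (∣ Q ∣ ≤_) (ℕ.+-comm s t) ∘ small)
      (subst (¬_ ∘ ColourableOn G B) (ℕ.+-comm s t) ¬col)
      (λ u∈B v~u → subst (_ ∈_) (∪-comm K L) (cover u∈B v~u))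
      (≮⇒≥ λ ∣L∣<t → <⇒≱ (ℕ.+-mono-< (≰⇒> s≰∣K∣) ∣L∣<t) s+t≤∣K∣+∣L∣))
  where
  χ≡1+s+t : χ G ≡ suc (s + t)
  χ≡1+s+t = trans χ≡s+1+t (ℕ.+-suc s t)

  small : ∀ {Q} → Clique G Q → ∣ Q ∣ ≤ s + t
  small {Q} clique = s≤s⁻¹ (subst (∣ Q ∣ <_) χ≡1+s+t
    (≤-<-trans (proj₂ (proj₂ (cliqueNumber G)) _ (Q , clique , refl)) ω<χ))

  ⊤-uncolourable : ¬ ColourableOn G ⊤ (s + t)
  ⊤-uncolourable (c , c< , proper) = ℕ.<-irrefl refl (subst (_≤ s + t) χ≡1+s+t
    (proj₂ (proj₂ (chromaticNumber G)) (s + t)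
      ((λ x → fromℕ< (c< (∈⊤ {x = x}))) ,
       λ x y x~y eq → proper ∈⊤ ∈⊤ x~y (fromℕ<-injective _ _ _ _ eq))))

  nonempty : ∀ {B} → ¬ ColourableOn G B (s + t) → Nonempty B
  nonempty {B} ¬col = decidable-stable (nonempty? B) λ B≡∅ →
    ¬col ((λ _ → 0) , (λ x∈B → contradiction (_ , x∈B) B≡∅) , λ x∈B _ _ _ → B≡∅ (_ , x∈B))
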